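{- For all non-negative integers $i<j$, there exists a graph $G$ with $\zeta_i(G)\neq\zeta_j(G)$.
   Context: Graphs are finite and connected. The $k$-visibility Localization game on a finite connected graph $G$ ($k\ge 0$ an integer) with $m$ cops: the robber first chooses a vertex of $G$. Then in each round the cops choose any vertices $u_1,\dots,u_m$ (no restriction relative to earlier placements), and cop $a$ receives the probe $d_a=d(u_a,x)$ if the robber's vertex $x$ satisfies $d(u_a,x)\le k$, and $d_a=\ast$ (no information) otherwise; afterwards the robber moves to a neighboring vertex or stays in place. A candidate is a vertex the robber may occupy, consistent with the information obtained so far. The cops win if they have a strategy that, whatever the robber does, determines after finitely many rounds a unique candidate (the robber is omniscient and knows the cops' entire strategy). The $k$-visibility localization number $\zeta_k(G)$ is the least positive integer $m$ for which $m$ cops have a winning strategy. -}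

module Defs where

open import Level using (0ℓ)
open import Data.Nat using (ℕ; zero; suc; _≤_; _≤?_; z≤n; s≤s; NonZero)
open import Data.Fin using (Fin; _≟_)
open import Data.Fin.Properties using (any?)
open import Data.List using (List; []; _∷_)
open import Data.Maybe using (Maybe; just; nothing)
open import Data.Product using (∃; ∃-syntax; ∃!; _×_; _,_; proj₁; proj₂)
open import Data.Sum using (_⊎_)
open import Data.Vec using (Vec; map)
open import Relation.Binary using (Rel; Symmetric; Decidable)
open import Relation.Binary.PropositionalEquality using (_≡_; refl)
open import Relation.Nullary using (Dec; yes; no; ¬_; contradiction)
open import Relation.Nullary.Decidable using (map′; _×-dec_; ⌊_⌋)
import Relation.Unary as U
open import Data.Bool using (if_then_else_)

data Walk {V : Set} (_~_ : Rel V 0ℓ) : ℕ → V → V → Set where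
  []  : ∀ {u} → Walk _~_ 0 u u
  _∷_ : ∀ {ℓ u w v} → u ~ w → Walk _~_ ℓ w v → Walk _~_ (suc ℓ) u v

record Graph : Set₁ where
  infix 4 _~_ _~?_
  field
    order     : ℕ
    .{{order≢0}} : NonZero order
    _~_       : Rel (Fin order) 0ℓ
    _~?_      : Decidable _~_
    ~-sym     : Symmetric _~_
    ~-irrefl  : ∀ {v} → ¬ (v ~ v)
    connected : ∀ u v → ∃[ ℓ ] Walk _~_ ℓ u v

  Vertex : Set
  Vertex = Fin order

least : {P : U.Pred ℕ 0ℓ} → U.Decidable P → ∀ n → P n →
        ∃[ d ] (P d × (∀ e → P e → d ≤ e))
least P? n p with P? 0
... | yes p₀ = 0 , p₀ , λ _ _ → z≤n
least P? zero    p | no ¬p₀ = contradiction p ¬p₀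
least P? (suc n) p | no ¬p₀ with least (λ m → P? (suc m)) n p
... | d , pd , min = suc d , pd , λ where
  zero    p₀ → contradiction p₀ ¬p₀
  (suc e) pe → s≤s (min e pe)

module _ (G : Graph) where
  open Graph G

  walk? : ∀ ℓ u v → Dec (Walk _~_ ℓ u v)
  walk? zero    u v = map′ (λ { refl → [] }) (λ { [] → refl }) (u ≟ v)
  walk? (suc ℓ) u v =
    map′ (λ { (_ , e , p) → e ∷ p }) (λ { (e ∷ p) → _ , e , p })
         (any? λ w → (u ~? w) ×-dec walk? ℓ w v)

  shortestWalk : ∀ u v →
    ∃[ d ] (Walk _~_ d u v × (∀ e → Walk _~_ e u v → d ≤ e))
  shortestWalk u v =
    least (λ ℓ → walk? ℓ u v) (proj₁ (connected u v)) (proj₂ (connected u v))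

  dist : Vertex → Vertex → ℕ
  dist u v = proj₁ (shortestWalk u v)

  -- `nothing` is the uninformative answer ∗.
  probe : ℕ → Vertex → Vertex → Maybe ℕ
  probe k u x = if ⌊ dist u x ≤? k ⌋ then just (dist u x) else nothing

  -- The answers of all completed rounds, most recent first.
  History : ℕ → Set
  History m = List (Vec (Maybe ℕ) m)

  Strategy : ℕ → Set
  Strategy m = History m → Vec Vertex m

  -- `position t` is the robber's vertex when the probes of round t are made;
  -- rounds are numbered from 0.
  record Trajectory : Set where
    field
      position : ℕ → Vertex
      move     : ∀ t → position (suc t) ≡ position t ⊎ position t ~ position (suc t)
  open Trajectory public

  -- `history k σ ρ t` consists of the answers in rounds 0, …, t - 1.
  history : ∀ {m} → ℕ → Strategy m → Trajectory → ℕ → History m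
  history k σ ρ zero    = []
  history k σ ρ (suc t) =
    map (λ u → probe k u (position ρ t)) (σ (history k σ ρ t)) ∷ history k σ ρ t

  -- When the robber follows ρ, x is a candidate after the probes of round t
  -- (and before the next move) if some trajectory giving exactly the same
  -- answers in rounds 0, …, t is at x in round t.
  Candidate : ∀ {m} → ℕ → Strategy m → Trajectory → ℕ → Vertex → Set
  Candidate k σ ρ t x =
    ∃[ ρ′ ] (history k σ ρ′ (suc t) ≡ history k σ ρ (suc t) × position ρ′ t ≡ x)

  -- As the robber knows the (deterministic) strategy in advance, its play is
  -- an arbitrary trajectory, chosen after σ.
  Winning : ∀ {m} → ℕ → Strategy m → Set
  Winning k σ = ∀ ρ → ∃[ t ] ∃! _≡_ (Candidate k σ ρ t)

  CopsWin : ℕ → ℕ → Set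
  CopsWin k m = ∃[ σ ] Winning {m} k σ

-- `IsLocalizationNumber k G m` says ζ_k(G) = m.
IsLocalizationNumber : ℕ → Graph → ℕ → Set
IsLocalizationNumber k G m =
  1 ≤ m × CopsWin G k m × (∀ m′ → 1 ≤ m′ → CopsWin G k m′ → m ≤ m′)

{-# OPTIONS --safe #-}
module Submission where

-- For i = 0 take the path on three vertices: one cop at an end locates the robber with
-- visibility 1, while with visibility 0 a single probe always leaves two vertices, and any
-- two vertices of the path dominate it, so the robber is never located.
--
-- For i ≥ 1 take a K₄, attach a path ("leg") of i further edges to three of its vertices,
-- and join one new vertex ("apex") to the tops of legs 0 and 1, another to the tops of legs
-- 0 and 2. Each apex is at distance i + 1 from exactly two vertices of the K₄. With
-- visibility j > i, two cops at the apexes locate every vertex at once, whereas one cop sees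
-- at most two different distances on the K₄. With visibility i each probe separates at
-- most one vertex of the K₄ from the others, so two cops always leave a pair, from which the
-- robber reaches all of the K₄ again; three cops locate every vertex at once.

open import Level using (0ℓ)
open import Data.Bool using (if_then_else_)
open import Data.Nat
open import Data.Nat.Properties
open import Data.Fin using (Fin; zero; suc; toℕ; fromℕ; fromℕ<; inject₁)
import Data.Fin as Fin
import Data.Fin.Properties as Fin
open import Data.List using ([]; _∷_)
open import Data.List.Properties using (∷-injectiveˡ)
open import Data.Maybe using (Maybe; just; nothing)
open import Data.Maybe.Properties using (just-injective)
open import Data.Product using (∃-syntax; _×_; _,_; proj₁; proj₂)
open import Data.Sum using (_⊎_; inj₁; inj₂; swap; fromInj₂; [_,_]′)
open import Data.Sum.Function.Propositional using (_⊎-↔_)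
open import Data.Vec using (Vec; []; _∷_; map)
import Data.Vec.Properties as Vec
open import Data.Vec.Relation.Unary.All using (All; []; _∷_)
open import Function.Base using (_∘_)
open import Function.Bundles using (_↔_; Inverse)
open import Function.Construct.Composition using (_↔-∘_)
open import Function.Construct.Identity using (↔-id)
open import Function.Definitions using (Injective)
open import Relation.Binary using (Rel; Symmetric; Decidable; tri<; tri≈; tri>)
open import Relation.Binary.PropositionalEquality
open import Relation.Nullary using (¬_; yes; no; contradiction)
open import Relation.Nullary.Decidable
  using (map′; _×-dec_; _⊎-dec_; ¬?; from-yes; ⌊_⌋)
open import Defs

-- Walks, and potentials bounding their length from below

snoc : ∀ {V : Set} {E : Rel V 0ℓ} {ℓ x y z} →
       Walk E ℓ x y → E y z → Walk E (suc ℓ) x z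
snoc []      e = e ∷ []
snoc (d ∷ p) e = d ∷ snoc p e

concat : ∀ {V : Set} {E : Rel V 0ℓ} {ℓ m x y z} →
         Walk E ℓ x y → Walk E m y z → Walk E (ℓ + m) x z
concat []      q = q
concat (d ∷ p) q = d ∷ concat p q

reverse : ∀ {V : Set} {E : Rel V 0ℓ} → Symmetric E →
          ∀ {ℓ x y} → Walk E ℓ x y → Walk E ℓ y x
reverse E-sym []      = []
reverse E-sym (d ∷ p) = snoc (reverse E-sym p) (E-sym d)

mapWalk : ∀ {V W : Set} {E : Rel V 0ℓ} {F : Rel W 0ℓ} (f : V → W) →
          (∀ {x y} → E x y → F (f x) (f y)) →
          ∀ {ℓ x y} → Walk E ℓ x y → Walk F ℓ (f x) (f y)
mapWalk f h []      = []
mapWalk f h (d ∷ p) = h d ∷ mapWalk f h p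

-- Lower bounds on distances come from such potentials: one that vanishes at the source never
-- exceeds the distance from it. For symmetric `E` the one-sided inequality bounds the change in
-- both directions.
Lipschitz : ∀ {V : Set} → Rel V 0ℓ → (V → ℕ) → Set
Lipschitz E f = ∀ {x y} → E x y → f y ≤ suc (f x)

lipschitz-walk : ∀ {V : Set} {E : Rel V 0ℓ} {f} → Lipschitz E f →
                 ∀ {ℓ x y} → Walk E ℓ x y → f y ≤ ℓ + f x
lipschitz-walk lip []               = ≤-refl
lipschitz-walk {f = f} lip {suc ℓ} {x} {y} (_∷_ {w = w} d p) = begin
  f y            ≤⟨ lipschitz-walk lip p ⟩
  ℓ + f w        ≤⟨ +-monoʳ-≤ ℓ (lip d) ⟩
  ℓ + suc (f x)  ≡⟨ +-suc ℓ (f x) ⟩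
  suc ℓ + f x    ∎
  where open ≤-Reasoning

-- Probe answers and locating in a single round

-- A probe depends on the distance alone: `probe k u x` unfolds to `answer k (dist u x)`.
answer : ℕ → ℕ → Maybe ℕ
answer k d = if ⌊ d ≤? k ⌋ then just d else nothing

-- Visibility k conveys at least the distance capped at k′ + 1, for any k′ ≤ k.
answer-cap : ∀ {k k′} → k′ ≤ k → ∀ d e → answer k d ≡ answer k e →
             d ⊓ suc k′ ≡ e ⊓ suc k′
answer-cap {k} {k′} k′≤k d e eq with d ≤? k | e ≤? k
... | yes _   | yes _   = cong (_⊓ suc k′) (just-injective eq)
... | no  d≰k | no  e≰k = trans (capped d≰k) (sym (capped e≰k))
  where
  capped : ∀ {d} → ¬ d ≤ k → d ⊓ suc k′ ≡ suc k′
  capped d≰k = m≥n⇒m⊓n≡n (≤-trans (s≤s k′≤k) (≰⇒> d≰k))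

answer-∗ : ∀ {k} d → k < d → answer k d ≡ nothing
answer-∗ {k} d k<d with d ≤? k
... | yes d≤k = contradiction d≤k (<⇒≱ k<d)
... | no  _   = refl

-- A constant strategy wins in round 0: a candidate has the robber's answers there, and these
-- determine the vertex.
resolving⇒CopsWin : ∀ (G : Graph) {k m} (us : Vec (Graph.Vertex G) m) →
  (∀ x y → map (λ u → probe G k u x) us ≡ map (λ u → probe G k u y) us → x ≡ y) →
  CopsWin G k m
resolving⇒CopsWin G us resolving = (λ _ → us) , λ ρ →
  0 , position ρ 0 , (ρ , refl , refl) ,
  λ { (ρ′ , eq , refl) → resolving _ _ (sym (∷-injectiveˡ eq)) }

-- A criterion for the robber to evade

module Evasion (G : Graph) where
  open Graph G

  Near : Rel Vertex 0ℓ
  Near x y = y ≡ x ⊎ x ~ y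

  near-sym : Symmetric Near
  near-sym (inj₁ eq) = inj₁ (sym eq)
  near-sym (inj₂ e)  = inj₂ (~-sym e)

  constant : Vertex → Trajectory G
  constant x = record { position = λ _ → x ; move = λ _ → inj₁ refl }

  -- Follows `p` up to and including round `t`, is at `z` in round `t + 1`, and stays there.
  divert : (ℕ → Vertex) → ℕ → Vertex → ℕ → Vertex
  divert p t       z zero    = p zero
  divert p zero    z (suc s) = z
  divert p (suc t) z (suc s) = divert (λ r → p (suc r)) t z s

  divert-move : ∀ p t z → (∀ s → Near (p s) (p (suc s))) → Near (p t) z →
                ∀ s → Near (divert p t z s) (divert p t z (suc s))
  divert-move p zero    z mv nr zero    = nr
  divert-move p zero    z mv nr (suc s) = inj₁ refl
  divert-move p (suc zero)    z mv nr zero = mv zero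
  divert-move p (suc (suc t)) z mv nr zero = mv zero
  divert-move p (suc t) z mv nr (suc s) =
    divert-move (λ r → p (suc r)) t z (λ r → mv (suc r)) nr s

  divert-before : ∀ p t z {s} → s ≤ t → divert p t z s ≡ p s
  divert-before p t       z z≤n       = refl
  divert-before p (suc t) z (s≤s s≤t) = divert-before (λ r → p (suc r)) t z s≤t

  divert-after : ∀ p t z → divert p t z (suc t) ≡ z
  divert-after p zero    z = refl
  divert-after p (suc t) z = divert-after (λ r → p (suc r)) t z

  diverted : (ρ : Trajectory G) → ∀ t z → Near (position ρ t) z → Trajectory G
  diverted ρ t z nr = record
    { position = divert (position ρ) t z
    ; move     = divert-move (position ρ) t z (move ρ) nr
    }

  module _ {k m : ℕ} (σ : Strategy G m) where

    answers : Vec Vertex m → Vertex → Vec (Maybe ℕ) m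
    answers us x = map (λ u → probe G k u x) us

    history-cong : ∀ ρ ρ′ t → (∀ {s} → s < t → position ρ s ≡ position ρ′ s) →
                   history G k σ ρ t ≡ history G k σ ρ′ t
    history-cong ρ ρ′ zero    eq = refl
    history-cong ρ ρ′ (suc t) eq =
      cong₂ (λ x h → answers (σ h) x ∷ h)
            (eq ≤-refl) (history-cong ρ ρ′ t λ s<t → eq (m<n⇒m<1+n s<t))

    history-diverted : ∀ ρ t z nr →
      history G k σ (diverted ρ t z nr) (2 + t) ≡
      answers (σ (history G k σ ρ (suc t))) z ∷ history G k σ ρ (suc t)
    history-diverted ρ t z nr =
      cong₂ (λ x h → answers (σ h) x ∷ h)
            (divert-after (position ρ) t z)
            (history-cong (diverted ρ t z nr) ρ (suc t)
               λ s<1+t → divert-before (position ρ) t z (≤-pred s<1+t))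

    -- The criterion: any two vertices of the core together dominate the core, and every placement
    -- of the cops gets equal answers at two core vertices. Two candidates then survive every round.
    module _ {C : Set} (core : C → Vertex) (core-inj : Injective _≡_ _≡_ core)
             (dominating : ∀ {x y} → x ≢ y → ∀ z →
                Near (core x) (core z) ⊎ Near (core y) (core z))
             (confused : ∀ us → ∃[ x ] ∃[ y ]
                x ≢ y × answers us (core x) ≡ answers us (core y)) where

      -- The fugitive is at x while y is another candidate: of the next two confused vertices
      -- it moves to a near one, and the other is near x or y.
      record Stage : Set where
        field
          past      : History G m
          x y       : C
          x≢y       : x ≢ y
          same      : answers (σ past) (core x) ≡ answers (σ past) (core y)

      open Stage

      stage : ℕ → Stage
      next  : ∀ (S : Stage) → ∃[ S′ ] Near (core (x S)) (core (x S′)) ×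
                past S′ ≡ answers (σ (past S)) (core (x S)) ∷ past S

      next S = orient (confused _)
        where
        -- The confused pair is ordered so that its first vertex is reachable from `x S`. Domination
        -- says which of the two reaches `x S`, hence the use of `near-sym`.
        orient : (∃[ p ] ∃[ q ] p ≢ q × answers _ (core p) ≡ answers _ (core q)) → _
        orient (p , q , p≢q , eq) = [
          (λ nr → record { past = _ ; x = p ; y = q ; x≢y = p≢q ; same = eq } ,
                  near-sym nr , refl) ,
          (λ nr → record { past = _ ; x = q ; y = p ; x≢y = ≢-sym p≢q ; same = sym eq } ,
                  near-sym nr , refl)
          ]′ (dominating p≢q (x S))

      stage zero =
        let p , q , p≢q , eq = confused (σ []) in
        record { past = [] ; x = p ; y = q ; x≢y = p≢q ; same = eq }
      stage (suc t) = proj₁ (next (stage t))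

      fugitive : Trajectory G
      fugitive = record
        { position = λ t → core (x (stage t))
        ; move     = λ t → proj₁ (proj₂ (next (stage t)))
        }

      -- The stages carry their own `past` because the trajectory is built from them; this
      -- identifies it with the history actually played.
      history-fugitive : ∀ t → history G k σ fugitive t ≡ past (stage t)
      history-fugitive zero    = refl
      history-fugitive (suc t) = trans
        (cong (λ h → answers (σ h) (core (x (stage t))) ∷ h) (history-fugitive t))
        (sym (proj₂ (proj₂ (next (stage t)))))

      same-answers : ∀ t → let us = σ (history G k σ fugitive t) in
                     answers us (core (y (stage t))) ≡ answers us (core (x (stage t)))
      same-answers t = subst
        (λ h → answers (σ h) (core (y (stage t))) ≡ answers (σ h) (core (x (stage t))))
        (sym (history-fugitive t)) (sym (same (stage t)))

      -- Induction on `t`: the new `y` is near the old `x` or the old `y`. In the first case the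
      -- fugitive itself is diverted to it, in the second the trajectory that witnesses the old `y`.
      -- The answers agree since the new `x` and `y` are confused.
      other : ∀ t → Candidate G k σ fugitive t (core (y (stage t)))

      other-next : ∀ t ρ → history G k σ ρ (suc t) ≡ history G k σ fugitive (suc t) →
                   Near (position ρ t) (core (y (stage (suc t)))) →
                   Candidate G k σ fugitive (suc t) (core (y (stage (suc t))))
      other-next t ρ eq nr =
        diverted ρ t z nr ,
        trans (history-diverted ρ t z nr)
              (trans (cong (λ h → answers (σ h) z ∷ h) eq)
                     (cong (_∷ history G k σ fugitive (suc t)) (same-answers (suc t)))) ,
        divert-after (position ρ) t z
        where z = core (y (stage (suc t)))

      other zero    = constant _ , cong (_∷ []) (same-answers 0) , refl
      other (suc t) = [
        other-next t fugitive refl ,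
        (λ nr → let ρ , eq , at-y = other t in
                other-next t ρ eq (subst (λ v → Near v (core (y (stage (suc t))))) (sym at-y) nr))
        ]′ (dominating (x≢y (stage t)) (y (stage (suc t))))

      ¬winning : ¬ Winning G k σ
      ¬winning win = x≢y (stage t) (core-inj
        (trans (sym (unique (fugitive , refl , refl))) (unique (other t))))
        where
        t = proj₁ (win fugitive)
        unique = proj₂ (proj₂ (proj₂ (win fugitive)))

-- Graphs presented on a structured vertex type

-- The vertices of a `Graph` are numbers in `Fin order`. A model transports walks and distances
-- along a bijection with `V`, so that the combinatorics can be done by cases on `V`.
record Model {V : Set} (E : Rel V 0ℓ) : Set₁ where
  field
    graph : Graph

  open Graph graph using (Vertex; _~_; ~-sym)

  field
    at        : V → Vertex
    name      : Vertex → V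
    name-at   : ∀ x → name (at x) ≡ x
    at-name   : ∀ u → at (name u) ≡ u
    at-edge   : ∀ {x y} → E x y → at x ~ at y
    name-edge : ∀ {u v} → u ~ v → E (name u) (name v)

  δ : V → V → ℕ
  δ x y = dist graph (at x) (at y)

  δ-geodesic : ∀ x y → Walk E (δ x y) x y
  δ-geodesic x y = subst₂ (Walk E _) (name-at x) (name-at y)
    (mapWalk name name-edge (proj₁ (proj₂ (shortestWalk graph (at x) (at y)))))

  walk⇒δ≤ : ∀ {ℓ x y} → Walk E ℓ x y → δ x y ≤ ℓ
  walk⇒δ≤ p = proj₂ (proj₂ (shortestWalk graph _ _)) _ (mapWalk at at-edge p)

  lipschitz⇒≤δ : ∀ {f} → Lipschitz E f → ∀ x y → f y ≤ δ x y + f x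
  lipschitz⇒≤δ lip x y = lipschitz-walk lip (δ-geodesic x y)

  δ-sym : ∀ x y → δ x y ≡ δ y x
  δ-sym x y = ≤-antisym (half x y) (half y x)
    where
    half : ∀ x y → δ x y ≤ δ y x
    half x y = proj₂ (proj₂ (shortestWalk graph (at x) (at y))) _
      (reverse ~-sym (proj₁ (proj₂ (shortestWalk graph (at y) (at x)))))

  -- `locate` decodes a vertex from distances capped at `k′ + 1`. By `answer-cap` the answers
  -- determine these capped distances, so a left inverse makes the placement resolving.
  locating⇒CopsWin : ∀ {k k′ m} (us : Vec V m) (locate : Vec ℕ m → V) →
    (∀ x → locate (map (λ u → δ u x ⊓ suc k′) us) ≡ x) →
    k′ ≤ k → CopsWin graph k m
  locating⇒CopsWin {k} {k′} us locate located k′≤k =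
    resolving⇒CopsWin graph (map at us) resolving
    where
    responses : ∀ {m} → Vec V m → Graph.Vertex graph → Vec _ m
    responses us v = map (λ w → probe graph k w v) (map at us)

    caps : ∀ {m} (us : Vec V m) x y → responses us (at x) ≡ responses us (at y) →
      map (λ w → δ w x ⊓ suc k′) us ≡ map (λ w → δ w y ⊓ suc k′) us
    caps []       x y eq = refl
    caps (w ∷ us) x y eq = cong₂ _∷_
      (answer-cap k′≤k (δ w x) (δ w y) (Vec.∷-injectiveˡ eq))
      (caps us x y (Vec.∷-injectiveʳ eq))

    resolving : ∀ u v → responses us u ≡ responses us v → u ≡ v
    resolving u v eq = begin
      u                 ≡⟨ at-name u ⟨
      at (name u)       ≡⟨ cong at (located (name u)) ⟨
      at (locate _)     ≡⟨ cong (at ∘ locate) (caps us (name u) (name v)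
                             (trans (cong (responses us) (at-name u))
                               (trans eq (cong (responses us) (sym (at-name v)))))) ⟩
      at (locate _)     ≡⟨ cong at (located (name v)) ⟩
      at (name v)       ≡⟨ at-name v ⟩
      v                 ∎
      where open ≡-Reasoning

model : ∀ {V : Set} {n} .{{_ : NonZero n}} → Fin n ↔ V →
        {E : Rel V 0ℓ} → Decidable E → Symmetric E → (∀ {x} → ¬ E x x) →
        (∀ x y → ∃[ ℓ ] Walk E ℓ x y) → Model E
model {n = n} label {E} E? E-sym E-irrefl E-conn = record
  { graph = record
    { order     = n
    ; _~_       = λ u v → E (name u) (name v)
    ; _~?_      = λ u v → E? (name u) (name v)
    ; ~-sym     = E-sym
    ; ~-irrefl  = E-irrefl
    ; connected = λ u v → let ℓ , p = E-conn (name u) (name v) in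
        ℓ , subst₂ (Walk _ ℓ) (strictlyInverseʳ u) (strictlyInverseʳ v)
              (mapWalk at at-edge p)
    }
  ; at        = at
  ; name      = name
  ; name-at   = strictlyInverseˡ
  ; at-name   = strictlyInverseʳ
  ; at-edge   = at-edge
  ; name-edge = λ e → e
  }
  where
  open Inverse label renaming (to to name; from to at)
  at-edge : ∀ {x y} → E x y → E (name (at x)) (name (at y))
  at-edge = subst₂ E (sym (strictlyInverseˡ _)) (sym (strictlyInverseˡ _))

-- The path on three vertices

module Path₃ where

  E : Rel (Fin 3) 0ℓ
  E x y = toℕ y ≡ suc (toℕ x) ⊎ toℕ x ≡ suc (toℕ y)

  E? : Decidable E
  E? x y = (toℕ y ≟ suc (toℕ x)) ⊎-dec (toℕ x ≟ suc (toℕ y))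

  E-irrefl : ∀ {x} → ¬ E x x
  E-irrefl (inj₁ eq) = 1+n≢n (sym eq)
  E-irrefl (inj₂ eq) = 1+n≢n (sym eq)

  E-conn : ∀ x y → ∃[ ℓ ] Walk E ℓ x y
  E-conn x y = _ , concat (reverse swap (proj₂ (from-0 x))) (proj₂ (from-0 y))
    where
    from-0 : ∀ x → ∃[ ℓ ] Walk E ℓ zero x
    from-0 zero             = _ , []
    from-0 (suc zero)       = _ , inj₁ refl ∷ []
    from-0 (suc (suc zero)) = _ , _∷_ {w = suc zero} (inj₁ refl) (inj₁ refl ∷ [])

  open Model (model (↔-id (Fin 3)) E? swap E-irrefl E-conn) public

  open Evasion graph using (Near; ¬winning)

  -- Capped at 1, a distance only tells whether the cop stands on the robber's vertex; the third
  -- vertex is found by elimination.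
  two-cops : CopsWin graph 0 2
  two-cops = locating⇒CopsWin (zero ∷ suc zero ∷ []) locate located ≤-refl
    where
    locate : Vec ℕ 2 → Fin 3
    locate (zero  ∷ _     ∷ []) = zero
    locate (suc _ ∷ zero  ∷ []) = suc zero
    locate (suc _ ∷ suc _ ∷ []) = suc (suc zero)

    located : ∀ x → locate _ ≡ x
    located zero             = refl
    located (suc zero)       = refl
    located (suc (suc zero)) = refl

  one-cop : ∀ {j} → 1 ≤ j → CopsWin graph j 1
  one-cop = locating⇒CopsWin (zero ∷ []) locate located
    where
    locate : Vec ℕ 1 → Fin 3
    locate (zero        ∷ []) = zero
    locate (suc zero    ∷ []) = suc zero
    locate (suc (suc _) ∷ []) = suc (suc zero)

    located : ∀ x → locate _ ≡ x
    located zero             = refl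
    located (suc zero)       = refl
    located (suc (suc zero)) = refl

  ¬one-cop : ¬ CopsWin graph 0 1
  ¬one-cop (σ , win) = ¬winning σ (λ x → x) (λ eq → eq) dominating confused win
    where
    near? : Decidable Near
    near? x y = (y Fin.≟ x) ⊎-dec E? x y

    dominating : ∀ {x y} → x ≢ y → ∀ z → Near x z ⊎ Near y z
    dominating {x} {y} x≢y z = fromInj₂ (λ x≡y → contradiction x≡y x≢y)
      (from-yes (Fin.all? λ x → Fin.all? λ y → Fin.all? λ z →
         (x Fin.≟ y) ⊎-dec (near? x z ⊎-dec near? y z)) x y z)

    confused : ∀ us → ∃[ x ] ∃[ y ] x ≢ y ×
      map (λ u → probe graph 0 u x) us ≡ map (λ u → probe graph 0 u y) us
    -- The two vertices not occupied by the cop both answer `nothing`.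
    confused (zero ∷ [])             = suc zero , suc (suc zero) , (λ ()) , refl
    confused (suc zero ∷ [])         = zero , suc (suc zero) , (λ ()) , refl
    confused (suc (suc zero) ∷ [])   = zero , suc zero , (λ ()) , refl

-- The spider: a K₄ with three legs and two apexes

-- The distance in a complete graph on `Fin n`.
gap : ∀ {n} → Fin n → Fin n → ℕ
gap x y with x Fin.≟ y
... | yes _ = 0
... | no  _ = 1

gap-refl : ∀ {n} (x : Fin n) → gap x x ≡ 0
gap-refl x with x Fin.≟ x
... | yes _   = refl
... | no  x≢x = contradiction refl x≢x

gap-≢ : ∀ {n} {x y : Fin n} → x ≢ y → gap x y ≡ 1
gap-≢ {x = x} {y} x≢y with x Fin.≟ y
... | yes x≡y = contradiction x≡y x≢y
... | no  _   = refl

gap≤1 : ∀ {n} (x y : Fin n) → gap x y ≤ 1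
gap≤1 x y with x Fin.≟ y
... | yes _ = z≤n
... | no  _ = ≤-refl

module Spider (i : ℕ) where

  -- `leg r zero` is the foot of leg `r` and belongs to the K₄, whose fourth vertex is `hub`; a leg
  -- thus has `i + 1` vertices and `i` edges.
  V : Set
  V = (Fin 3 × Fin (suc i)) ⊎ Fin 3

  pattern leg r a = inj₁ (r , a)
  pattern hub     = inj₂ zero
  pattern apex s  = inj₂ (suc s)

  data Edge : Rel V 0ℓ where
    rise  : ∀ {r a b} → toℕ b ≡ suc (toℕ a) → Edge (leg r a) (leg r b)
    base  : ∀ {r s} → r ≢ s → Edge (leg r zero) (leg s zero)
    spoke : ∀ {r} → Edge (leg r zero) hub
    cap   : ∀ {r s a} → r ≡ zero ⊎ r ≡ suc s → toℕ a ≡ i → Edge (leg r a) (apex s)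

  edge? : Decidable Edge
  edge? (leg r a) (leg s b) = map′
    (λ { (inj₁ (refl , eq)) → rise eq ; (inj₂ (r≢s , refl , refl)) → base r≢s })
    (λ { (rise eq) → inj₁ (refl , eq) ; (base r≢s) → inj₂ (r≢s , refl , refl) })
    ((r Fin.≟ s) ×-dec (toℕ b ≟ suc (toℕ a))
      ⊎-dec (¬? (r Fin.≟ s) ×-dec ((a Fin.≟ zero) ×-dec (b Fin.≟ zero))))
  edge? (leg r a) hub      = map′ (λ { refl → spoke }) (λ { spoke → refl }) (a Fin.≟ zero)
  edge? (leg r a) (apex s) = map′
    (λ { (l , eq) → cap l eq }) (λ { (cap l eq) → l , eq })
    (((r Fin.≟ zero) ⊎-dec (r Fin.≟ suc s)) ×-dec (toℕ a ≟ i))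
  edge? (inj₂ _) y = no λ ()

  E : Rel V 0ℓ
  E x y = Edge x y ⊎ Edge y x

  E? : Decidable E
  E? x y = edge? x y ⊎-dec edge? y x

  edge-irrefl : ∀ {x} → ¬ Edge x x
  edge-irrefl (rise eq)  = contradiction eq (<⇒≢ ≤-refl)
  edge-irrefl (base r≢r) = r≢r refl

  E-irrefl : ∀ {x} → ¬ E x x
  E-irrefl (inj₁ e) = edge-irrefl e
  E-irrefl (inj₂ e) = edge-irrefl e

  core : Fin 4 → V
  core zero    = hub
  core (suc r) = leg r zero

  top : Fin (suc i)
  top = fromℕ i

  toℕ≤i : ∀ (a : Fin (suc i)) → toℕ a ≤ i
  toℕ≤i = Fin.toℕ≤pred[n]

  -- The number of steps is a separate argument tied down by an additive equation; recursion on it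
  -- removes the topmost edge.
  climb : ∀ r (a b : Fin (suc i)) n → toℕ a + n ≡ toℕ b → Walk E n (leg r a) (leg r b)
  climb r a b zero eq
    with refl ← Fin.toℕ-injective (trans (sym (+-identityʳ _)) eq) = []
  climb r a zero (suc n) eq = contradiction (trans (sym (+-suc (toℕ a) n)) eq) λ ()
  climb r a (suc b) (suc n) eq = snoc
    (climb r a (inject₁ b) n
      (trans (suc-injective (trans (sym (+-suc (toℕ a) n)) eq)) (sym (Fin.toℕ-inject₁ b))))
    (inj₁ (rise (cong suc (sym (Fin.toℕ-inject₁ b)))))

  core-edge : ∀ {h h′} → h ≢ h′ → E (core h) (core h′)
  core-edge {zero}  {zero}  h≢h = contradiction refl h≢h
  core-edge {zero}  {suc s} _   = inj₂ spoke
  core-edge {suc r} {zero}  _   = inj₁ spoke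
  core-edge {suc r} {suc s} r≢s = inj₁ (base (r≢s ∘ cong suc))

  core-walk : ∀ h h′ → Walk E (gap h h′) (core h) (core h′)
  core-walk h h′ with h Fin.≟ h′
  ... | yes refl = []
  ... | no  h≢h′ = core-edge h≢h′ ∷ []

  core-leg : ∀ h r a → Walk E (gap h (suc r) + toℕ a) (core h) (leg r a)
  core-leg h r a = concat (core-walk h (suc r)) (climb r zero a (toℕ a) refl)

  apex-leg : ∀ {s r} → r ≡ zero ⊎ r ≡ suc s → ∀ a →
             Walk E (suc (i ∸ toℕ a)) (apex s) (leg r a)
  apex-leg l a = inj₂ (cap l (Fin.toℕ-fromℕ i)) ∷
    reverse swap (climb _ a top (i ∸ toℕ a)
      (trans (m+[n∸m]≡n (toℕ≤i a)) (sym (Fin.toℕ-fromℕ i))))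

  E-conn : ∀ x y → ∃[ ℓ ] Walk E ℓ x y
  E-conn x y = _ , concat (reverse swap (proj₂ (from-hub x))) (proj₂ (from-hub y))
    where
    from-hub : ∀ x → ∃[ ℓ ] Walk E ℓ hub x
    from-hub (leg r a) = _ , core-leg zero r a
    from-hub hub       = _ , []
    from-hub (apex s)  = _ , snoc (core-leg zero zero top)
                                  (inj₁ (cap (inj₁ refl) (Fin.toℕ-fromℕ i)))

  label : Fin (3 * suc i + 3) ↔ V
  label = (Fin.*↔× {3} {suc i} ⊎-↔ ↔-id (Fin 3)) ↔-∘ Fin.+↔⊎ {3 * suc i} {3}

  spider : Model E
  spider = model label E? swap E-irrefl E-conn

-- Distances in the spider

module Game (i : ℕ) (M : Model (Spider.E i)) where

  open Spider i
  open Model M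

  lipschitz : ∀ f → (∀ {x y} → Edge x y → f y ≤ suc (f x) × f x ≤ suc (f y)) →
              Lipschitz E f
  lipschitz f h (inj₁ e) = proj₁ (h e)
  lipschitz f h (inj₂ e) = proj₂ (h e)

  within : ∀ {m n} c → m ≤ 1 → n ≤ 1 → c + m ≤ suc (c + n)
  within {m} {n} c m≤1 n≤1 = begin
    c + m         ≤⟨ +-monoʳ-≤ c m≤1 ⟩
    c + 1         ≡⟨ +-comm c 1 ⟩
    suc c         ≤⟨ s≤s (m≤m+n c n) ⟩
    suc (c + n)   ∎
    where open ≤-Reasoning

  -- The exact distance from `core h` on the legs and the hub. At an apex the value is only a lower
  -- bound, but one that already exceeds visibility `i`.
  fromCore : Fin 4 → V → ℕ
  fromCore h (leg r a) = toℕ a + gap h (suc r)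
  fromCore h hub       = gap h zero
  fromCore h (apex s)  = suc i

  fromCore-lipschitz : ∀ h → Lipschitz E (fromCore h)
  fromCore-lipschitz h = lipschitz (fromCore h) λ where
    (rise {r} {a} {b} eq) →
      ≤-reflexive (cong (_+ gap h (suc r)) eq) ,
      ≤-trans (n≤1+n _) (≤-trans (≤-reflexive (cong (_+ gap h (suc r)) (sym eq))) (n≤1+n _))
    (base {r} {s} _) → within 0 (gap≤1 h (suc s)) (gap≤1 h (suc r)) ,
                       within 0 (gap≤1 h (suc r)) (gap≤1 h (suc s))
    (spoke {r}) → within 0 (gap≤1 h zero) (gap≤1 h (suc r)) ,
                  within 0 (gap≤1 h (suc r)) (gap≤1 h zero)
    (cap {r} {a = a} _ eq) → s≤s (≤-trans (≤-reflexive (sym eq)) (m≤m+n (toℕ a) _)) ,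
      ≤-trans (within (toℕ a) (gap≤1 h (suc r)) (z≤n {1}))
              (s≤s (≤-trans (≤-reflexive (trans (+-identityʳ _) eq)) (n≤1+n _)))

  detour : Fin 2 → Fin 3 → ℕ
  detour s zero    = 0
  detour s (suc t) = gap s t

  detour≤1 : ∀ s r → detour s r ≤ 1
  detour≤1 s zero    = z≤n
  detour≤1 s (suc t) = gap≤1 s t

  -- Exact at the hub and on the two legs attached to `apex s`. On the remaining leg and at the
  -- other apex it is a lower bound, sufficient to tell which apex is nearer.
  fromApex : Fin 2 → V → ℕ
  fromApex s (leg r a) = suc (i ∸ toℕ a) + detour s r
  fromApex s hub       = suc (suc i)
  fromApex s (apex t)  = gap s t

  ∸-step : ∀ a {b} → b ≡ suc a → i ∸ a ≤ suc (i ∸ b)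
  ∸-step a refl = ≤-trans (m≤n+m∸n (i ∸ a) 1)
    (s≤s (≤-reflexive (trans (∸-+-assoc i a 1) (cong (i ∸_) (+-comm a 1)))))

  detour≤gap : ∀ s {r t} → r ≡ zero ⊎ r ≡ suc t → detour s r ≤ gap s t
  detour≤gap s (inj₁ refl) = z≤n
  detour≤gap s (inj₂ refl) = ≤-refl

  fromApex-lipschitz : ∀ s → Lipschitz E (fromApex s)
  fromApex-lipschitz s = lipschitz (fromApex s) λ where
    (rise {r} {a} {b} eq) →
      ≤-trans (+-monoˡ-≤ (detour s r)
                (s≤s (∸-monoʳ-≤ i (≤-trans (n≤1+n _) (≤-reflexive (sym eq))))))
              (n≤1+n _) ,
      s≤s (+-monoˡ-≤ (detour s r) (∸-step (toℕ a) eq))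
    (base {r} {t} _) → within (suc i) (detour≤1 s t) (detour≤1 s r) ,
                       within (suc i) (detour≤1 s r) (detour≤1 s t)
    (spoke {r}) → s≤s (s≤s (m≤m+n i _)) ,
      ≤-trans (within (suc i) (detour≤1 s r) (z≤n {1}))
              (s≤s (≤-trans (≤-reflexive (+-identityʳ _)) (n≤1+n _)))
    (cap {r} {t} {a} l eq) → ≤-trans (gap≤1 s t) (s≤s z≤n) ,
      ≤-trans (≤-reflexive (cong (λ n → suc n + detour s r)
                             (m≤n⇒m∸n≡0 (≤-reflexive (sym eq)))))
              (s≤s (detour≤gap s l))

  core≤ : ∀ h x → fromCore h x ≤ δ (core h) x
  core≤ h x = begin
    fromCore h x                          ≤⟨ lipschitz⇒≤δ (fromCore-lipschitz h) (core h) x ⟩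
    δ (core h) x + fromCore h (core h)    ≡⟨ cong (δ (core h) x +_) (source h) ⟩
    δ (core h) x + 0                      ≡⟨ +-identityʳ _ ⟩
    δ (core h) x                          ∎
    where
    open ≤-Reasoning
    source : ∀ h → fromCore h (core h) ≡ 0
    source zero    = gap-refl {4} zero
    source (suc r) = gap-refl (suc r)

  apex≤ : ∀ s x → fromApex s x ≤ δ (apex s) x
  apex≤ s x = begin
    fromApex s x                         ≤⟨ lipschitz⇒≤δ (fromApex-lipschitz s) (apex s) x ⟩
    δ (apex s) x + fromApex s (apex s)   ≡⟨ cong (δ (apex s) x +_) (gap-refl s) ⟩
    δ (apex s) x + 0                     ≡⟨ +-identityʳ _ ⟩
    δ (apex s) x                         ∎
    where open ≤-Reasoning

  δ-core-leg : ∀ h r a → δ (core h) (leg r a) ≡ toℕ a + gap h (suc r)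
  δ-core-leg h r a = ≤-antisym
    (≤-trans (walk⇒δ≤ (core-leg h r a)) (≤-reflexive (+-comm (gap h (suc r)) (toℕ a))))
    (core≤ h (leg r a))

  δ-core-hub : ∀ h → δ (core h) hub ≡ gap h zero
  δ-core-hub h = ≤-antisym (walk⇒δ≤ (core-walk h zero)) (core≤ h hub)

  δ-apex-leg : ∀ {s r} → r ≡ zero ⊎ r ≡ suc s → ∀ a →
               δ (apex s) (leg r a) ≡ suc (i ∸ toℕ a)
  δ-apex-leg {s} {r} l a = ≤-antisym (walk⇒δ≤ (apex-leg l a))
    (≤-trans (m≤m+n _ (detour s r)) (apex≤ s (leg r a)))

  δ-leg-core : ∀ r a {h} → h ≢ suc r → δ (leg r a) (core h) ≡ toℕ a + 1
  δ-leg-core r a {h} h≢ = trans (δ-sym (leg r a) (core h))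
    (trans (δ-core-leg h r a) (cong (toℕ a +_) (gap-≢ h≢)))

  δ-hub-core : ∀ {h} → h ≢ zero → δ hub (core h) ≡ 1
  δ-hub-core {h} h≢ =
    trans (δ-sym hub (core h)) (trans (δ-core-hub h) (gap-≢ h≢))

  -- Too few cops on the spider

  -- A leg vertex is equally far from all of the K₄ except its own foot, the hub from all three
  -- feet, and an apex from the feet of its two legs. Equal distances give equal answers at every
  -- visibility, so this defeats one cop for all `k`.
  twins : ∀ z → ∃[ x ] ∃[ y ] x ≢ y × δ z (core x) ≡ δ z (core y)
  twins (leg r a) =
    zero , suc s , (λ ()) ,
    trans (δ-leg-core r a λ ()) (sym (δ-leg-core r a (s≢r ∘ Fin.suc-injective)))
    where
    another : ∀ (r : Fin 3) → ∃[ s ] s ≢ r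
    another zero    = suc zero , λ ()
    another (suc _) = zero , λ ()
    s = proj₁ (another r)
    s≢r = proj₂ (another r)
  twins hub =
    suc zero , suc (suc zero) , (λ ()) ,
    trans (δ-hub-core λ ()) (sym (δ-hub-core λ ()))
  twins (apex s) =
    suc zero , suc (suc s) , (λ ()) ,
    trans (δ-apex-leg (inj₁ refl) zero) (sym (δ-apex-leg (inj₂ refl) zero))

  -- `h` is the only vertex of the K₄ that a cop at `z` can single out with visibility `i`: the foot
  -- of its leg, or the hub. From an apex the whole K₄ is out of sight and `zero` is an arbitrary
  -- choice.
  blind-spot : ∀ z → ∃[ h ] ∀ {x y} → x ≢ h → y ≢ h →
    δ z (core x) ≡ δ z (core y) ⊎ (i < δ z (core x) × i < δ z (core y))
  blind-spot (leg r a) = suc r , λ x≢ y≢ →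
    inj₁ (trans (δ-leg-core r a x≢) (sym (δ-leg-core r a y≢)))
  blind-spot hub = zero , λ x≢ y≢ →
    inj₁ (trans (δ-hub-core x≢) (sym (δ-hub-core y≢)))
  blind-spot (apex s) = zero , λ {x} {y} _ _ → inj₂ (unseen x , unseen y)
    where
    unseen : ∀ h → i < δ (apex s) (core h)
    unseen h = ≤-trans (core≤ h (apex s)) (≤-reflexive (δ-sym (core h) (apex s)))

  open Evasion graph using (Near; ¬winning)

  core-inj : Injective _≡_ _≡_ core
  core-inj {zero}  {zero}  _    = refl
  core-inj {suc _} {suc _} refl = refl

  at-core-inj : Injective _≡_ _≡_ (at ∘ core)
  at-core-inj eq = core-inj (trans (sym (name-at _)) (trans (cong name eq) (name-at _)))

  clique : ∀ x y → Near (at (core x)) (at (core y))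
  clique x y with x Fin.≟ y
  ... | yes refl = inj₁ refl
  ... | no  x≢y  = inj₂ (at-edge (core-edge x≢y))

  -- The evasion criterion applied to the K₄: in a clique each vertex dominates by itself, and two
  -- equal or two invisible distances give the same answer.
  confusing⇒¬CopsWin : ∀ {k m} →
    (∀ (zs : Vec V m) → ∃[ x ] ∃[ y ] x ≢ y × All
      (λ z → δ z (core x) ≡ δ z (core y) ⊎ (k < δ z (core x) × k < δ z (core y))) zs) →
    ¬ CopsWin graph k m
  confusing⇒¬CopsWin {k} confusing (σ , win) =
    ¬winning σ (at ∘ core) at-core-inj (λ {x} _ z → inj₁ (clique x z)) confused win
    where
    confused : ∀ us → ∃[ x ] ∃[ y ] x ≢ y ×
      map (λ u → probe graph k u (at (core x))) us ≡
      map (λ u → probe graph k u (at (core y))) us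
    confused us =
      let x , y , x≢y , alike = confusing (map name us) in
      x , y , x≢y , agree us alike
      where
      agree : ∀ {m x y} (us : Vec _ m) → All
        (λ z → δ z (core x) ≡ δ z (core y) ⊎ (k < δ z (core x) × k < δ z (core y)))
        (map name us) →
        map (λ u → probe graph k u (at (core x))) us ≡
        map (λ u → probe graph k u (at (core y))) us
      agree [] [] = refl
      agree {x = x} {y} (u ∷ us) (d ∷ ds) = cong₂ _∷_
        (subst (λ v → probe graph k v (at (core x)) ≡ probe graph k v (at (core y)))
               (at-name u)
               ([ cong (answer k) ,
                  (λ (k<d , k<e) → trans (answer-∗ _ k<d) (sym (answer-∗ _ k<e))) ]′ d))
        (agree us ds)

  ¬one-cop : ∀ k → ¬ CopsWin graph k 1
  ¬one-cop k = confusing⇒¬CopsWin λ where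
    (z ∷ []) → let x , y , x≢y , eq = twins z in x , y , x≢y , inj₁ eq ∷ []

  opaque
    -- Two cops single out at most two of the four vertices, which leaves a pair they confuse;
    -- checked over all cases.
    avoid : ∀ (g h : Fin 4) → ∃[ x ] ∃[ y ]
            x ≢ y × (x ≢ g × y ≢ g) × (x ≢ h × y ≢ h)
    avoid = from-yes (Fin.all? {4} λ g → Fin.all? {4} λ h → Fin.any? {4} λ x → Fin.any? {4} λ y →
      ¬? (x Fin.≟ y) ×-dec
      ((¬? (x Fin.≟ g) ×-dec ¬? (y Fin.≟ g)) ×-dec (¬? (x Fin.≟ h) ×-dec ¬? (y Fin.≟ h))))

  ¬two-cops : ¬ CopsWin graph i 2
  ¬two-cops = confusing⇒¬CopsWin λ where
    (z ∷ w ∷ []) →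
      let g , dz = blind-spot z
          h , dw = blind-spot w
          x , y , x≢y , (x≢g , y≢g) , (x≢h , y≢h) = avoid g h
      in x , y , x≢y , dz x≢g y≢g ∷ dw x≢h y≢h ∷ []

  -- Enough cops on the spider

  -- The argument counts steps down from the top, as distances from an apex do.
  height : ℕ → Fin (suc i)
  height c = fromℕ< (s≤s (m∸n≤m i c))

  height-depth : ∀ a → height (i ∸ toℕ a) ≡ a
  height-depth a = Fin.toℕ-injective
    (trans (Fin.toℕ-fromℕ< _) (m∸[m∸n]≡n (toℕ≤i a)))

  opaque
    -- Decoding by the nearer of two cops: each has a side of its own on which it is strictly
    -- nearer, and ties form a third class.
    branch : ℕ → ℕ → (ℕ → V) → (ℕ → V) → (ℕ → V) → V
    branch v w f g h with <-cmp v w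
    ... | tri< _ _ _ = f v
    ... | tri≈ _ _ _ = g v
    ... | tri> _ _ _ = h w

  opaque
    unfolding branch

    branch-< : ∀ {v w d} {f g h : ℕ → V} → v ≡ d → d < w → branch v w f g h ≡ f d
    branch-< {v} {w} refl v<w with <-cmp v w
    ... | tri< _ _ _   = refl
    ... | tri≈ v≮w _ _ = contradiction v<w v≮w
    ... | tri> v≮w _ _ = contradiction v<w v≮w

    branch-≡ : ∀ {v w d} {f g h : ℕ → V} → v ≡ d → w ≡ d → branch v w f g h ≡ g d
    branch-≡ {v} refl refl with <-cmp v v
    ... | tri< _ v≢v _ = contradiction refl v≢v
    ... | tri≈ _ _ _   = refl
    ... | tri> _ v≢v _ = contradiction refl v≢v

    branch-> : ∀ {v w d} {f g h : ℕ → V} → d < v → w ≡ d → branch v w f g h ≡ h d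
    branch-> {v} {w} w<v refl with <-cmp v w
    ... | tri< _ _ v≯w = contradiction w<v v≯w
    ... | tri≈ _ _ v≯w = contradiction w<v v≯w
    ... | tri> _ _ _   = refl

  cap-exact : ∀ {d e n} → d ≡ e → e ≤ n → d ⊓ n ≡ e
  cap-exact refl d≤n = m≤n⇒m⊓n≡m d≤n

  -- Distances from the apexes, capped at `i + 2`. Leg 0 and the hub give ties, at most `i + 1` on
  -- the leg and `i + 2` at the hub; everything else is strictly nearer to one apex, and that
  -- distance fixes the vertex.
  two-cops : ∀ {j} → i < j → CopsWin graph j 2
  two-cops = locating⇒CopsWin cops locate located
    where
    cops : Vec V 2
    cops = apex zero ∷ apex (suc zero) ∷ []

    shared : ℕ → V
    -- A tie at 0 never occurs, so this is a default value.
    shared zero    = hub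
    shared (suc c) with c ≤? i
    ... | yes _ = leg zero (height c)
    ... | no  _ = hub

    side : Fin 2 → ℕ → V
    side s zero    = apex s
    side s (suc c) = leg (suc s) (height c)

    locate : Vec ℕ 2 → V
    locate (v ∷ w ∷ []) = branch v w (side zero) shared (side (suc zero))

    shared-leg : ∀ a → shared (suc (i ∸ toℕ a)) ≡ leg zero a
    shared-leg a with i ∸ toℕ a ≤? i
    ... | yes _  = cong (λ b → leg zero b) (height-depth a)
    ... | no  ≰i = contradiction (m∸n≤m i (toℕ a)) ≰i

    shared-hub : shared (suc (suc i)) ≡ hub
    shared-hub with suc i ≤? i
    ... | yes i<i = contradiction i<i (<-irrefl refl)
    ... | no  _   = refl

    side-leg : ∀ s a → side s (suc (i ∸ toℕ a)) ≡ leg (suc s) a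
    side-leg s a = cong (λ b → leg (suc s) b) (height-depth a)

    near : ∀ {s r} → r ≡ zero ⊎ r ≡ suc s → ∀ a →
           δ (apex s) (leg r a) ⊓ suc (suc i) ≡ suc (i ∸ toℕ a)
    near l a = cap-exact (δ-apex-leg l a) (s≤s (≤-trans (m∸n≤m i (toℕ a)) (n≤1+n i)))

    -- The detour costs at least one step, and the cap `i + 2` is large enough to keep the
    -- inequality strict.
    far : ∀ {s t} → s ≢ t → ∀ a →
          suc (i ∸ toℕ a) < δ (apex s) (leg (suc t) a) ⊓ suc (suc i)
    far {s} {t} s≢t a = ⊓-glb
      (≤-trans (≤-reflexive (trans (cong suc (+-comm 1 _))
                                   (cong (suc (i ∸ toℕ a) +_) (sym (gap-≢ s≢t)))))
               (apex≤ s (leg (suc t) a)))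
      (s≤s (s≤s (m∸n≤m i (toℕ a))))

    far-hub : ∀ s → δ (apex s) hub ⊓ suc (suc i) ≡ suc (suc i)
    far-hub s = m≥n⇒m⊓n≡n (apex≤ s hub)

    self : ∀ s → δ (apex s) (apex s) ⊓ suc (suc i) ≡ 0
    self s = cap-exact (n≤0⇒n≡0 (walk⇒δ≤ [])) z≤n

    opposite : ∀ {s t} → s ≢ t → 0 < δ (apex s) (apex t) ⊓ suc (suc i)
    opposite {s} {t} s≢t = ⊓-glb
      (≤-trans (≤-reflexive (sym (gap-≢ s≢t))) (apex≤ s (apex t))) (s≤s z≤n)

    located : ∀ x → locate (map (λ u → δ u x ⊓ suc (suc i)) cops) ≡ x
    located (leg zero a) =
      trans (branch-≡ (near (inj₁ refl) a) (near (inj₁ refl) a)) (shared-leg a)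
    located (leg (suc zero) a) =
      trans (branch-< (near (inj₂ refl) a) (far (λ ()) a)) (side-leg zero a)
    located (leg (suc (suc zero)) a) =
      trans (branch-> (far (λ ()) a) (near (inj₂ refl) a)) (side-leg (suc zero) a)
    located hub = trans (branch-≡ (far-hub zero) (far-hub (suc zero))) shared-hub
    located (apex zero)       = branch-< (self zero) (opposite λ ())
    located (apex (suc zero)) = branch-> (opposite λ ()) (self (suc zero))

  -- The feet of legs 0 and 1 are each strictly nearer to their own leg. Leg 2, the hub and the
  -- apexes give ties, at `a + 1`, 1 and the cap `i + 1`; the cop at the top of leg 2 separates
  -- these. The hypothesis `1 ≤ i` keeps the cap different from 1, which distinguishes the apexes
  -- from the hub and from each other.
  three-cops : 1 ≤ i → CopsWin graph i 3
  three-cops 1≤i = locating⇒CopsWin cops locate located ≤-refl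
    where
    tip : V
    tip = leg (suc (suc zero)) top

    cops : Vec V 3
    cops = core (suc zero) ∷ core (suc (suc zero)) ∷ tip ∷ []

    -- z is the capped distance to the tip, d the common one to the two cops on the K₄.
    middle : ℕ → ℕ → V
    middle z d with z ≟ i ∸ pred d | d ≟ 1 | z ≟ 1
    ... | yes _ | _     | _     = leg (suc (suc zero)) (height (i ∸ pred d))
    ... | no  _ | yes _ | _     = hub
    ... | no  _ | no  _ | yes _ = apex (suc zero)
    ... | no  _ | no  _ | no  _ = apex zero

    middle-leg : ∀ a {z} → z ≡ i ∸ toℕ a → middle z (suc (toℕ a)) ≡ leg (suc (suc zero)) a
    middle-leg a {z} eq with z ≟ i ∸ toℕ a
    ... | yes _ = cong (λ b → leg (suc (suc zero)) b) (height-depth a)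
    ... | no ≢  = contradiction eq ≢

    middle-hub : ∀ {z} → z ≡ suc i → middle z 1 ≡ hub
    middle-hub refl with suc i ≟ i
    ... | yes 1+i≡i = contradiction 1+i≡i 1+n≢n
    ... | no  _     = refl

    middle-apex₁ : ∀ {z} → z ≡ 1 → middle z (suc i) ≡ apex (suc zero)
    middle-apex₁ refl with 1 ≟ i ∸ i | suc i ≟ 1
    ... | yes 1≡ | _     = contradiction (trans 1≡ (n∸n≡0 i)) λ ()
    ... | no  _  | yes ≡1 = contradiction (suc-injective ≡1) (≢-sym (<⇒≢ 1≤i))
    ... | no  _  | no  _ = refl

    middle-apex₀ : ∀ {z} → 1 < z → middle z (suc i) ≡ apex zero
    middle-apex₀ {z} 1<z with z ≟ i ∸ i | suc i ≟ 1 | z ≟ 1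
    ... | yes z≡ | _      | _      =
      contradiction (≤-trans 1<z (≤-reflexive (trans z≡ (n∸n≡0 i)))) λ ()
    ... | no  _  | yes ≡1 | _      = contradiction (suc-injective ≡1) (≢-sym (<⇒≢ 1≤i))
    ... | no  _  | no  _  | yes z≡1 = contradiction (sym z≡1) (<⇒≢ 1<z)
    ... | no  _  | no  _  | no  _  = refl

    -- Index `v` counted from the foot, truncated at the top to make it total.
    rung : ℕ → Fin (suc i)
    rung v = height (i ∸ v)

    locate : Vec ℕ 3 → V
    locate (v ∷ w ∷ z ∷ []) =
      branch v w (λ a → leg zero (rung a)) (middle z) (λ a → leg (suc zero) (rung a))

    own : ∀ r a → δ (core (suc r)) (leg r a) ⊓ suc i ≡ toℕ a
    own r a = cap-exact
      (trans (δ-core-leg (suc r) r a)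
        (trans (cong (toℕ a +_) (gap-refl (suc r))) (+-identityʳ _)))
      (≤-trans (toℕ≤i a) (n≤1+n i))

    other : ∀ {r s} → r ≢ s → ∀ a → δ (core (suc r)) (leg s a) ⊓ suc i ≡ suc (toℕ a)
    other {r} {s} r≢s a = cap-exact
      (trans (δ-core-leg (suc r) s a)
        (trans (cong (toℕ a +_) (gap-≢ (r≢s ∘ Fin.suc-injective))) (+-comm _ 1)))
      (s≤s (toℕ≤i a))

    spokes : ∀ r → δ (core (suc r)) hub ⊓ suc i ≡ 1
    spokes r = cap-exact (trans (δ-core-hub (suc r)) (gap-≢ {x = suc r} {zero} λ ())) (s≤s z≤n)

    unseen : ∀ h s → δ (core h) (apex s) ⊓ suc i ≡ suc i
    unseen h s = m≥n⇒m⊓n≡n (core≤ h (apex s))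

    tip-leg : ∀ a → δ tip (leg (suc (suc zero)) a) ⊓ suc i ≡ i ∸ toℕ a
    tip-leg a = cap-exact (≤-antisym upper lower) (≤-trans (m∸n≤m i (toℕ a)) (n≤1+n i))
      where
      x = leg (suc (suc zero)) a
      h = suc (suc (suc zero))
      upper = walk⇒δ≤ (reverse swap (climb (suc (suc zero)) a top (i ∸ toℕ a)
                (trans (m+[n∸m]≡n (toℕ≤i a)) (sym (Fin.toℕ-fromℕ i)))))
      lower : i ∸ toℕ a ≤ δ tip x
      -- The potential of the foot of leg 2 rises from `toℕ a` at `x` to `i` at the tip.
      lower = m≤n+o⇒m∸n≤o i (toℕ a) (begin
        i                              ≡⟨ Fin.toℕ-fromℕ i ⟨
        toℕ top                        ≤⟨ m≤m+n (toℕ top) _ ⟩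
        fromCore h tip                 ≤⟨ lipschitz⇒≤δ (fromCore-lipschitz h) x tip ⟩
        δ x tip + (toℕ a + gap h h)    ≡⟨ cong₂ _+_ (δ-sym x tip) (+-identityʳ (toℕ a)) ⟩
        δ tip x + toℕ a                ≡⟨ +-comm (δ tip x) (toℕ a) ⟩
        toℕ a + δ tip x                ∎)
        where open ≤-Reasoning

    tip-hub : δ tip hub ⊓ suc i ≡ suc i
    tip-hub = m≥n⇒m⊓n≡n (begin
      suc i              ≡⟨ +-comm 1 i ⟩
      i + 1              ≡⟨ cong (_+ 1) (Fin.toℕ-fromℕ i) ⟨
      fromCore zero tip  ≤⟨ core≤ zero tip ⟩
      δ hub tip          ≡⟨ δ-sym hub tip ⟩
      δ tip hub          ∎)
      where open ≤-Reasoning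

    tip-apex : ∀ s → suc (detour s (suc (suc zero))) ≤ δ tip (apex s)
    tip-apex s = begin
      suc (detour s (suc (suc zero)))   ≤⟨ s≤s (m≤n+m _ (i ∸ toℕ top)) ⟩
      fromApex s tip                    ≤⟨ apex≤ s tip ⟩
      δ (apex s) tip                    ≡⟨ δ-sym (apex s) tip ⟩
      δ tip (apex s)                    ∎
      where open ≤-Reasoning

    tip-apex₁ : δ tip (apex (suc zero)) ⊓ suc i ≡ 1
    tip-apex₁ = cap-exact
      (≤-antisym (walk⇒δ≤ (inj₁ (cap (inj₂ refl) (Fin.toℕ-fromℕ i)) ∷ [])) (tip-apex (suc zero)))
      (s≤s z≤n)

    tip-apex₀ : 1 < δ tip (apex zero) ⊓ suc i
    tip-apex₀ = ⊓-glb (tip-apex zero) (s≤s 1≤i)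

    located : ∀ x → locate (map (λ u → δ u x ⊓ suc i) cops) ≡ x
    located (leg zero a) =
      trans (branch-< (own zero a) (≤-reflexive (sym (other (λ ()) a))))
            (cong (λ b → leg zero b) (height-depth a))
    located (leg (suc zero) a) =
      trans (branch-> (≤-reflexive (sym (other (λ ()) a))) (own (suc zero) a))
            (cong (λ b → leg (suc zero) b) (height-depth a))
    located (leg (suc (suc zero)) a) =
      trans (branch-≡ (other (λ ()) a) (other (λ ()) a)) (middle-leg a (tip-leg a))
    located hub =
      trans (branch-≡ (spokes zero) (spokes (suc zero))) (middle-hub tip-hub)
    located (apex zero) =
      trans (branch-≡ (unseen _ zero) (unseen _ zero)) (middle-apex₀ tip-apex₀)
    located (apex (suc zero)) =
      trans (branch-≡ (unseen _ (suc zero)) (unseen _ (suc zero))) (middle-apex₁ tip-apex₁)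

-- Values of the localization numbers: 2 and 1 on the path, 3 and 2 on the spider

mainTheorem4 : ∀ (i j : ℕ) → i < j →
    ∃[ G ] ∃[ a ] ∃[ b ]
    (IsLocalizationNumber i G a × IsLocalizationNumber j G b × a ≢ b)
mainTheorem4 zero j 0<j =
  graph , 2 , 1 ,
  (s≤s z≤n , two-cops , λ where
    1       _ win → contradiction win ¬one-cop
    (2+ m)  _ _   → s≤s (s≤s z≤n)) ,
  (≤-refl , one-cop 0<j , λ _ 1≤m _ → 1≤m) ,
  λ ()
  where open Path₃
mainTheorem4 (suc i) j i<j =
  graph , 3 , 2 ,
  (s≤s z≤n , three-cops (s≤s z≤n) , λ where
    1             _ win → contradiction win (¬one-cop (suc i))
    2             _ win → contradiction win ¬two-cops
    (suc (2+ m))  _ _   → s≤s (s≤s (s≤s z≤n))) ,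
  (s≤s z≤n , two-cops i<j , λ where
    1       _ win → contradiction win (¬one-cop j)
    (2+ m)  _ _   → s≤s (s≤s z≤n)) ,
  λ ()
  where
  open Spider (suc i)
  open Model spider using (graph)
  open Game (suc i) spider
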